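{- For all integers $m \geqslant 1$, both graphs $\varDelta_m[-1]$ and $\varDelta_m[1]$ (the red and blue subgraphs of the edge-coloured graph $\varDelta_m$ defined in the context) are strongly regular, with parameters $v_m = 4^m$, $k_m = 2^{2m-1} - 2^{m-1}$, $\lambda_m = \mu_m = 2^{2m-2} - 2^{m-1}$.
   Context: Strongly regular graphs. A simple graph of order $v$ is strongly regular with parameters $(v,k,\lambda,\mu)$ if each vertex has degree $k$, each adjacent pair of vertices has $\lambda$ common neighbours, and each nonadjacent pair of (distinct) vertices has $\mu$ common neighbours. Canonical basis matrices. Let $\mathrm{E}_1 := \begin{pmatrix} 0 & -1 \\ 1 & 0 \end{pmatrix}$ and $\mathrm{E}_2 := \begin{pmatrix} 0 & 1 \\ 1 & 0 \end{pmatrix}$. Define $\gamma_1$ on $\mathbb{Z}_2^2$ (bit pairs) by $\gamma_1(00) = I$, $\gamma_1(01) = \mathrm{E}_1$, $\gamma_1(10) = \mathrm{E}_2$, $\gamma_1(11) = \mathrm{E}_1\mathrm{E}_2$. For $m > 1$, define $\gamma_m$ on $\mathbb{Z}_2^{2m}$ by $\gamma_m(p \odot i) := \gamma_1(p) \otimes \gamma_{m-1}(i)$ for $p \in \mathbb{Z}_2^2$, $i \in \mathbb{Z}_2^{2m-2}$, where $\odot$ denotes concatenation of bit vectors and $\otimes$ the Kronecker product. The $4^m$ matrices $\gamma_m(i)$, $i \in \mathbb{Z}_2^{2m}$, each of size $2^m \times 2^m$, are the canonical basis matrices of the real representation of the Clifford algebra $\mathbb{R}_{m,m}$. The graph $\varDelta_m$.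 $\varDelta_m$ is the graph whose vertices are these $4^m$ canonical basis matrices, with each edge having one of two colours, $-1$ (red) and $1$ (blue): matrices $A_j$ and $A_k$ are connected by a red edge if they have disjoint support (no position at which both have a nonzero entry) and $A_j A_k^{ -1}$ is skew (skew-symmetric); they are connected by a blue edge if they have disjoint support and $A_j A_k^{ -1}$ is symmetric; otherwise there is no edge between $A_j$ and $A_k$. The red subgraph $\varDelta_m[-1]$ has all the vertices of $\varDelta_m$ and all of its red edges; the blue subgraph $\varDelta_m[1]$ has all the vertices of $\varDelta_m$ and all of its blue edges. -}

module Defs where

open import Data.Fin.Base using (Fin; quotient; remainder)
open import Data.Fin.Patterns using (0F; 1F)
open import Data.Fin.Properties using (_≟_)
open import Data.Integer.Base using (ℤ; 0ℤ; 1ℤ; -1ℤ; _*_; -_)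
open import Data.Integer.Properties using (+-*-semiring)
open import Data.List.Base using (List; length)
open import Data.List.Membership.Propositional using (_∈_)
open import Data.List.Relation.Unary.Unique.Propositional using (Unique)
open import Data.Nat.Base as ℕ using (ℕ; suc; _^_; NonZero)
open import Data.Product.Base using (Σ-syntax; ∃-syntax; _×_)
open import Data.Vec.Base using (Vec; []; _∷_; lookup; tabulate)
open import Function.Bundles using (_⇔_)
open import Level using (0ℓ)
open import Relation.Binary.Core using (Rel)
open import Relation.Binary.PropositionalEquality.Core using (_≡_; _≢_)
open import Relation.Nullary.Decidable.Core using (does)
open import Relation.Nullary.Negation.Core using (¬_)
open import Relation.Unary using (Pred)
open import Data.Bool.Base using (if_then_else_)

open import Algebra.Properties.Semiring.Sum +-*-semiring using (sum)

------------------------------------------------------------------------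
-- Strongly regular graphs

-- P has exactly n elements up to propositional equality.
HasSize : {A : Set} → Pred A 0ℓ → ℕ → Set
HasSize {A} P n =
  Σ[ xs ∈ List A ] Unique xs × (∀ x → (x ∈ xs) ⇔ P x) × length xs ≡ n

-- The vertex set is a subset of an ambient type, and two vertices are the same
-- when they are equal in that type.  `Adj` is only ever consulted on vertices.
-- That a graph is simple is part of `IsStronglyRegular`, not of this record.
record Graph : Set₁ where
  field
    Carrier : Set
    Vertex  : Pred Carrier 0ℓ
    Adj     : Rel Carrier 0ℓ

module _ (G : Graph) where
  open Graph G

  record IsSimple : Set where
    field
      irreflexive : ∀ {x} → Vertex x → ¬ Adj x x
      symmetric   : ∀ {x y} → Vertex x → Vertex y → Adj x y → Adj y x

  Neighbour : Carrier → Pred Carrier 0ℓ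
  Neighbour x z = Vertex z × Adj x z

  CommonNeighbour : Carrier → Carrier → Pred Carrier 0ℓ
  CommonNeighbour x y z = Vertex z × Adj x z × Adj y z

  record IsStronglyRegular (v k l μ : ℕ) : Set where
    field
      simple      : IsSimple
      order       : HasSize Vertex v
      degree      : ∀ {x} → Vertex x → HasSize (Neighbour x) k
      adjacent    : ∀ {x y} → Vertex x → Vertex y →
                    Adj x y → HasSize (CommonNeighbour x y) l
      nonadjacent : ∀ {x y} → Vertex x → Vertex y → x ≢ y →
                    ¬ Adj x y → HasSize (CommonNeighbour x y) μ

------------------------------------------------------------------------
-- Matrices

-- Every matrix in play is a signed permutation matrix, so integer entries
-- suffice: its real inverse is again integral, hence is its inverse over ℤ.
-- Vectors rather than functions are used so that equal entries give equal
-- matrices.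
Matrix : ℕ → ℕ → Set
Matrix m n = Vec (Vec ℤ n) m

private
  variable
    m n p q : ℕ

infix  9 _⟨_,_⟩
infixl 7 _*ᴹ_ _⊗_

_⟨_,_⟩ : Matrix m n → Fin m → Fin n → ℤ
A ⟨ i , j ⟩ = lookup (lookup A i) j

matrix : (Fin m → Fin n → ℤ) → Matrix m n
matrix f = tabulate λ i → tabulate λ j → f i j

𝟙 : Matrix n n
𝟙 = matrix λ i j → if does (i ≟ j) then 1ℤ else 0ℤ

_*ᴹ_ : Matrix m n → Matrix n p → Matrix m p
A *ᴹ B = matrix λ i j → sum λ k → A ⟨ i , k ⟩ * B ⟨ k , j ⟩

-- Kronecker product: the (a , b) block of size p × q is A ⟨ a , b ⟩ times B.
_⊗_ : Matrix m n → Matrix p q → Matrix (m ℕ.* p) (n ℕ.* q)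
_⊗_ {m} {n} {p} {q} A B = matrix λ i j →
  A ⟨ quotient p i , quotient q j ⟩ * B ⟨ remainder {m} p i , remainder {n} q j ⟩

IsInverse : Matrix n n → Matrix n n → Set
IsInverse A B = A *ᴹ B ≡ 𝟙 × B *ᴹ A ≡ 𝟙

Symmetric : Matrix n n → Set
Symmetric A = ∀ i j → A ⟨ j , i ⟩ ≡ A ⟨ i , j ⟩

Skew : Matrix n n → Set
Skew A = ∀ i j → A ⟨ j , i ⟩ ≡ - A ⟨ i , j ⟩

DisjointSupport : Matrix m n → Matrix m n → Set
DisjointSupport A B = ∀ i j → ¬ (A ⟨ i , j ⟩ ≢ 0ℤ × B ⟨ i , j ⟩ ≢ 0ℤ)

------------------------------------------------------------------------
-- Canonical basis matrices

E₁ E₂ : Matrix 2 2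
E₁ = (0ℤ ∷ -1ℤ ∷ []) ∷
     (1ℤ ∷ 0ℤ  ∷ []) ∷ []
E₂ = (0ℤ ∷ 1ℤ ∷ []) ∷
     (1ℤ ∷ 0ℤ ∷ []) ∷ []

γ₁ : Fin 2 → Fin 2 → Matrix 2 2
γ₁ 0F 0F = 𝟙
γ₁ 0F 1F = E₁
γ₁ 1F 0F = E₂
γ₁ 1F 1F = E₁ *ᴹ E₂

γ : ∀ m .{{_ : NonZero m}} → Vec (Fin 2) (m ℕ.* 2) → Matrix (2 ^ m) (2 ^ m)
γ 1             (a ∷ b ∷ []) = γ₁ a b
γ (suc (suc m)) (a ∷ b ∷ i)  = γ₁ a b ⊗ γ (suc m) i

CanonicalBasisMatrix : ∀ m .{{_ : NonZero m}} → Pred (Matrix (2 ^ m) (2 ^ m)) 0ℓ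
CanonicalBasisMatrix m A = ∃[ i ] γ m i ≡ A

------------------------------------------------------------------------
-- The edge-coloured graph Δ

-- red is the colour -1 and blue the colour 1.
data Colour : Set where
  red blue : Colour

-- In both clauses B is the inverse of A′.
Edge : Colour → Rel (Matrix n n) 0ℓ
Edge red  A A′ = DisjointSupport A A′ × (∃[ B ] IsInverse A′ B × Skew (A *ᴹ B))
Edge blue A A′ = DisjointSupport A A′ × (∃[ B ] IsInverse A′ B × Symmetric (A *ᴹ B))

Δ_[_] : ∀ m .{{_ : NonZero m}} → Colour → Graph
Δ m [ c ] = record
  { Carrier = Matrix (2 ^ m) (2 ^ m)
  ; Vertex  = CanonicalBasisMatrix m
  ; Adj     = Edge c
  }

{-# OPTIONS --safe #-}

-- For indices i, j let χ = ±1 be the sign with Mᵀ = χ M, where M = γ i (γ j)ᵀ, and let ζ be 1 if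
-- γ i and γ j have the same support and 0 otherwise.  The inverse of γ j is its transpose, distinct
-- supports are disjoint, and ζ = 1 forces χ = 1; so the indicators of a red and of a blue edge are
-- (1 - χ) / 2 and (1 + χ - 2 ζ) / 2.  Both χ and ζ are products over the digits of i and j in ℤ₂²,
-- hence so are the sums over k of χ(i,k), ζ(i,k) and of the products χ(i,k) χ(j,k), χ(i,k) ζ(j,k),
-- ζ(i,k) ζ(j,k): they are 2^m, 2^m, 4^m δ(i,j), 2^m ζ(i,j) and 2^m ζ(i,j).  Expanding the indicators
-- gives the degrees and the numbers of common neighbours, for both colours at once.
module Submission where

open import Defs
open import Data.Bool.Base using (_∧_; not; if_then_else_)
import Data.Bool.Properties as Bool
open import Data.Fin.Base
  using (Fin; zero; suc; _↑ˡ_; _↑ʳ_; combine; quotient; remainder)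
open import Data.Fin.Patterns using (0F; 1F)
open import Data.Fin.Properties
  using (_≟_; all?; any?; remQuot-combine; combine-remQuot)
open import Data.Integer.Base as ℤ using (ℤ; +_; 0ℤ; 1ℤ; -1ℤ; _+_; _-_; _*_; -_; ≢-nonZero)
import Data.Integer.Properties as ℤ
open import Data.Integer.Solver using (module +-*-Solver)
open import Data.List.Base
  using (List; []; _∷_; _++_; length; map; filter; foldr; allFin; cartesianProduct; cartesianProductWith)
open import Data.List.Membership.Propositional using (_∈_)
open import Data.List.Membership.Propositional.Properties
  using (∈-allFin; ∈-cartesianProduct⁺; ∈-cartesianProductWith⁺; ∈-filter⁺; ∈-filter⁻; ∈-map⁺; ∈-map⁻)
open import Data.List.Properties using (length-map; filter-accept; filter-reject)
import Data.List.Relation.Unary.All as All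
open import Data.List.Relation.Unary.AllPairs using ([]; _∷_)
open import Data.List.Relation.Unary.Any using (here)
open import Data.List.Relation.Unary.Unique.Propositional using (Unique)
open import Data.List.Relation.Unary.Unique.Propositional.Properties
  using (allFin⁺; cartesianProduct⁺; cartesianProductWith⁺; filter⁺; map⁺)
open import Data.Nat.Base as ℕ using (ℕ; zero; suc; _∸_; _^_; NonZero)
import Data.Nat.Properties as ℕ
open import Data.Product.Base using (∃₂; _×_; _,_; proj₁; proj₂; uncurry)
open import Data.Sum.Base using (_⊎_; inj₁; inj₂)
open import Data.Vec.Base as Vec using (Vec; []; _∷_; lookup; tabulate)
open import Data.Vec.Properties as Vec
  using (lookup∘tabulate; tabulate∘lookup; tabulate-cong)
open import Function.Base using (_∘_; id)
open import Function.Bundles using (mk⇔)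
open import Level using (0ℓ)
open import Relation.Binary.PropositionalEquality
  using (_≡_; _≢_; refl; sym; trans; cong; cong₂; subst; subst₂; module ≡-Reasoning)
open import Relation.Nullary.Decidable
  using (Dec; does; yes; no; dec-true; dec-false; from-yes; map′; _×-dec_; _⊎-dec_; ¬?)
open import Relation.Nullary.Negation using (¬_; contradiction)
open import Relation.Unary using (Pred; Decidable)

open import Algebra.Properties.Semiring.Sum ℤ.+-*-semiring
  using (sum; sum-cong-≗; sum-replicate-zero; ∑-comm; *-distribˡ-sum; *-distribʳ-sum)

open ≡-Reasoning

private
  variable
    X Y Z : Set
    m n p q r s : ℕ

-- Matrix algebra over ℤ: entries, finite sums, uniqueness of inverses.

infix 10 _ᵀ

_ᵀ : Matrix m n → Matrix n m
A ᵀ = matrix λ i j → A ⟨ j , i ⟩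

matrix-lookup : (f : Fin m → Fin n → ℤ) → ∀ i j → matrix f ⟨ i , j ⟩ ≡ f i j
matrix-lookup f i j = trans
  (cong (λ row → lookup row j) (lookup∘tabulate (λ i → tabulate (f i)) i))
  (lookup∘tabulate (f i) j)

ᵀ-lookup : (A : Matrix m n) → ∀ i j → A ᵀ ⟨ i , j ⟩ ≡ A ⟨ j , i ⟩
ᵀ-lookup A = matrix-lookup λ i j → A ⟨ j , i ⟩

𝟙-lookup : (i j : Fin n) → 𝟙 ⟨ i , j ⟩ ≡ (if does (i ≟ j) then 1ℤ else 0ℤ)
𝟙-lookup = matrix-lookup λ i j → if does (i ≟ j) then 1ℤ else 0ℤ

matrix-cong : {f g : Fin m → Fin n → ℤ} → (∀ i j → f i j ≡ g i j) → matrix f ≡ matrix g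
matrix-cong f≗g = tabulate-cong λ i → tabulate-cong (f≗g i)

matrix-η : (A : Matrix m n) → matrix (λ i j → A ⟨ i , j ⟩) ≡ A
matrix-η A = trans (tabulate-cong λ i → tabulate∘lookup (lookup A i)) (tabulate∘lookup A)

sum-δ : (i : Fin n) (f : Fin n → ℤ) →
        sum (λ k → (if does (i ≟ k) then 1ℤ else 0ℤ) * f k) ≡ f i
sum-δ {suc n} zero f = begin
  1ℤ * f zero + sum {n} (λ _ → 0ℤ)  ≡⟨ cong₂ _+_ (ℤ.*-identityˡ (f zero)) (sum-replicate-zero n) ⟩
  f zero + 0ℤ                       ≡⟨ ℤ.+-identityʳ (f zero) ⟩
  f zero                            ∎
sum-δ (suc i) f = trans (ℤ.+-identityˡ _) (sum-δ i (f ∘ suc))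

sum-++ : ∀ m {n} (f : Fin (m ℕ.+ n) → ℤ) →
         sum f ≡ sum (λ i → f (i ↑ˡ n)) + sum (λ j → f (m ↑ʳ j))
sum-++ zero    f = sym (ℤ.+-identityˡ _)
sum-++ (suc m) f = trans (cong (_+_ (f zero)) (sum-++ m (f ∘ suc))) (sym (ℤ.+-assoc (f zero) _ _))

sum-combine : ∀ m {n} (f : Fin (m ℕ.* n) → ℤ) →
              sum f ≡ sum {m} λ i → sum {n} λ j → f (combine i j)
sum-combine zero        f = refl
sum-combine (suc m) {n} f = trans (sum-++ n f)
  (cong (_+_ (sum λ j → f (j ↑ˡ (m ℕ.* n)))) (sum-combine m (f ∘ (n ↑ʳ_))))

quotient-combine : (i : Fin m) (j : Fin n) → quotient n (combine i j) ≡ i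
quotient-combine i j = cong proj₁ (remQuot-combine i j)

remainder-combine : (i : Fin m) (j : Fin n) → remainder {m} n (combine i j) ≡ j
remainder-combine i j = cong proj₂ (remQuot-combine i j)

-- `⊗` reads its indices through `quotient` and `remainder`, so this reindexing is what splits the
-- inner sum in a product of two Kronecker products.
sum-quotRem : (f : Fin m → Fin n → ℤ) →
              sum (λ k → f (quotient n k) (remainder {m} n k)) ≡ sum λ i → sum (f i)
sum-quotRem {m} {n} f = trans (sum-combine m _)
  (sum-cong-≗ λ i → sum-cong-≗ λ j →
    cong₂ f (quotient-combine i j) (remainder-combine i j))

sum-*-sum : (f : Fin m → ℤ) (g : Fin n → ℤ) →
            sum (λ i → sum λ j → f i * g j) ≡ sum f * sum g
sum-*-sum f g = begin
  sum (λ i → sum λ j → f i * g j)  ≡⟨ sum-cong-≗ (λ i → *-distribˡ-sum (f i) g) ⟨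
  sum (λ i → f i * sum g)          ≡⟨ *-distribʳ-sum (sum g) f ⟨
  sum f * sum g                    ∎

δ-sym : (i j : Fin n) → (if does (i ≟ j) then 1ℤ else 0ℤ) ≡ (if does (j ≟ i) then 1ℤ else 0ℤ)
δ-sym i j with i ≟ j
... | yes refl = cong (if_then 1ℤ else 0ℤ) (sym (dec-true (i ≟ i) refl))
... | no  i≢j  = cong (if_then 1ℤ else 0ℤ) (sym (dec-false (j ≟ i) (i≢j ∘ sym)))

*ᴹ-identityˡ : (A : Matrix m n) → 𝟙 *ᴹ A ≡ A
*ᴹ-identityˡ {m} A = trans (matrix-cong λ i j → trans
  (sum-cong-≗ {m} λ k → cong (_* A ⟨ k , j ⟩) (𝟙-lookup i k))
  (sum-δ i λ k → A ⟨ k , j ⟩)) (matrix-η A)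

*ᴹ-identityʳ : (A : Matrix m n) → A *ᴹ 𝟙 ≡ A
*ᴹ-identityʳ {n = n} A = trans (matrix-cong λ i j → trans
  (sum-cong-≗ {n} λ k → trans (ℤ.*-comm (A ⟨ i , k ⟩) _)
    (cong (_* A ⟨ i , k ⟩) (trans (𝟙-lookup k j) (δ-sym k j))))
  (sum-δ j λ k → A ⟨ i , k ⟩)) (matrix-η A)

*ᴹ-assoc : (A : Matrix m n) (B : Matrix n p) (C : Matrix p q) →
           (A *ᴹ B) *ᴹ C ≡ A *ᴹ (B *ᴹ C)
*ᴹ-assoc {n = n} {p = p} A B C = matrix-cong λ i j → begin
  sum (λ k → (A *ᴹ B) ⟨ i , k ⟩ * C ⟨ k , j ⟩)
    ≡⟨ sum-cong-≗ {p} (λ k → cong (_* C ⟨ k , j ⟩) (matrix-lookup _ i k)) ⟩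
  sum (λ k → sum (λ l → A ⟨ i , l ⟩ * B ⟨ l , k ⟩) * C ⟨ k , j ⟩)
    ≡⟨ sum-cong-≗ {p} (λ k → *-distribʳ-sum {n} (C ⟨ k , j ⟩) _) ⟩
  sum (λ k → sum λ l → A ⟨ i , l ⟩ * B ⟨ l , k ⟩ * C ⟨ k , j ⟩)
    ≡⟨ ∑-comm {p} {n} _ ⟩
  sum (λ l → sum λ k → A ⟨ i , l ⟩ * B ⟨ l , k ⟩ * C ⟨ k , j ⟩)
    ≡⟨ sum-cong-≗ {n} (λ l → sum-cong-≗ {p} λ k →
         ℤ.*-assoc (A ⟨ i , l ⟩) (B ⟨ l , k ⟩) (C ⟨ k , j ⟩)) ⟩
  sum (λ l → sum λ k → A ⟨ i , l ⟩ * (B ⟨ l , k ⟩ * C ⟨ k , j ⟩))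
    ≡⟨ sum-cong-≗ {n} (λ l → *-distribˡ-sum {p} (A ⟨ i , l ⟩) _) ⟨
  sum (λ l → A ⟨ i , l ⟩ * sum λ k → B ⟨ l , k ⟩ * C ⟨ k , j ⟩)
    ≡⟨ sum-cong-≗ {n} (λ l → cong (A ⟨ i , l ⟩ *_) (matrix-lookup _ l j)) ⟨
  sum (λ l → A ⟨ i , l ⟩ * (B *ᴹ C) ⟨ l , j ⟩) ∎

-- An `Edge` comes with some unspecified inverse; this allows the transpose to be put in its place.
inverse-unique : {A B C : Matrix n n} → IsInverse A B → IsInverse A C → B ≡ C
inverse-unique {A = A} {B} {C} (AB≡𝟙 , _) (_ , CA≡𝟙) = begin
  B               ≡⟨ *ᴹ-identityˡ B ⟨
  𝟙 *ᴹ B          ≡⟨ cong (_*ᴹ B) CA≡𝟙 ⟨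
  (C *ᴹ A) *ᴹ B   ≡⟨ *ᴹ-assoc C A B ⟩
  C *ᴹ (A *ᴹ B)   ≡⟨ cong (C *ᴹ_) AB≡𝟙 ⟩
  C *ᴹ 𝟙          ≡⟨ *ᴹ-identityʳ C ⟩
  C               ∎

-- Kronecker products and orthogonality of the basis matrices.

[ij][kl]≡[ik][jl] : ∀ i j k l → (i * j) * (k * l) ≡ (i * k) * (j * l)
[ij][kl]≡[ik][jl] = solve 4 (λ i j k l → (i :* j) :* (k :* l) := (i :* k) :* (j :* l)) refl
  where open +-*-Solver

⊗-lookup : (A : Matrix m n) (B : Matrix p q) → ∀ i j →
           (A ⊗ B) ⟨ i , j ⟩ ≡ A ⟨ quotient p i , quotient q j ⟩ * B ⟨ remainder {m} p i , remainder {n} q j ⟩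
⊗-lookup {m} {n} {p} {q} A B = matrix-lookup λ i j →
  A ⟨ quotient p i , quotient q j ⟩ * B ⟨ remainder {m} p i , remainder {n} q j ⟩

⊗-lookup-combine : (A : Matrix m n) (B : Matrix p q) → ∀ i j k l →
                   (A ⊗ B) ⟨ combine i k , combine j l ⟩ ≡ A ⟨ i , j ⟩ * B ⟨ k , l ⟩
⊗-lookup-combine A B i j k l = trans (⊗-lookup A B _ _) (cong₂ _*_
  (cong₂ (λ u v → A ⟨ u , v ⟩) (quotient-combine i k) (quotient-combine j l))
  (cong₂ (λ u v → B ⟨ u , v ⟩) (remainder-combine i k) (remainder-combine j l)))

-- The mixed-product rule: after regrouping, each summand is a term in the quotient times a term in
-- the remainder, so the double sum factors.
⊗-*ᴹ : (A : Matrix m n) (B : Matrix p q) (C : Matrix n r) (D : Matrix q s) →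
       (A ⊗ B) *ᴹ (C ⊗ D) ≡ (A *ᴹ C) ⊗ (B *ᴹ D)
⊗-*ᴹ {m} {n} {p} {q} {r} {s} A B C D = matrix-cong λ i j →
  let i₁ = quotient {m} p i; i₂ = remainder {m} p i
      j₁ = quotient {r} s j; j₂ = remainder {r} s j in begin
  sum (λ k → (A ⊗ B) ⟨ i , k ⟩ * (C ⊗ D) ⟨ k , j ⟩)
    ≡⟨ sum-cong-≗ {n ℕ.* q} (λ k → trans
         (cong₂ _*_ (⊗-lookup A B i k) (⊗-lookup C D k j))
         ([ij][kl]≡[ik][jl] (A ⟨ i₁ , quotient q k ⟩) _ (C ⟨ quotient q k , j₁ ⟩) _)) ⟩
  _ ≡⟨ sum-quotRem {n} {q} (λ a b → (A ⟨ i₁ , a ⟩ * C ⟨ a , j₁ ⟩) * (B ⟨ i₂ , b ⟩ * D ⟨ b , j₂ ⟩)) ⟩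
  _ ≡⟨ sum-*-sum {n} {q} (λ a → A ⟨ i₁ , a ⟩ * C ⟨ a , j₁ ⟩) _ ⟩
  sum (λ a → A ⟨ i₁ , a ⟩ * C ⟨ a , j₁ ⟩) * sum (λ b → B ⟨ i₂ , b ⟩ * D ⟨ b , j₂ ⟩)
    ≡⟨ cong₂ _*_ (matrix-lookup _ i₁ j₁) (matrix-lookup _ i₂ j₂) ⟨
  (A *ᴹ C) ⟨ i₁ , j₁ ⟩ * (B *ᴹ D) ⟨ i₂ , j₂ ⟩ ∎

⊗-ᵀ : (A : Matrix m n) (B : Matrix p q) → (A ⊗ B) ᵀ ≡ A ᵀ ⊗ B ᵀ
⊗-ᵀ A B = matrix-cong λ i j → trans (⊗-lookup A B j i)
  (sym (cong₂ _*_ (ᵀ-lookup A _ _) (ᵀ-lookup B _ _)))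

⊗-*ᴹ-ᵀ : (A : Matrix m n) (B : Matrix p q) (C : Matrix r n) (D : Matrix s q) →
         (A ⊗ B) *ᴹ (C ⊗ D) ᵀ ≡ (A *ᴹ C ᵀ) ⊗ (B *ᴹ D ᵀ)
⊗-*ᴹ-ᵀ A B C D = trans (cong ((A ⊗ B) *ᴹ_) (⊗-ᵀ C D)) (⊗-*ᴹ A B (C ᵀ) (D ᵀ))

𝟙⊗𝟙≡𝟙 : 𝟙 {m} ⊗ 𝟙 {n} ≡ 𝟙
𝟙⊗𝟙≡𝟙 {m} {n} = matrix-cong λ i j → trans
  (cong₂ _*_ (𝟙-lookup (quotient {m} n i) (quotient {m} n j))
               (𝟙-lookup (remainder {m} n i) (remainder {m} n j)))
  (entry i j)
  where
  entry : (i j : Fin (m ℕ.* n)) →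
          (if does (quotient {m} n i ≟ quotient n j) then 1ℤ else 0ℤ) *
          (if does (remainder {m} n i ≟ remainder {m} n j) then 1ℤ else 0ℤ) ≡
          (if does (i ≟ j) then 1ℤ else 0ℤ)
  entry i j with i ≟ j | quotient {m} n i ≟ quotient n j | remainder {m} n i ≟ remainder {m} n j
  ... | yes refl | yes _ | yes _ = refl
  ... | yes refl | no q≢ | _     = contradiction refl q≢
  ... | yes refl | yes _ | no r≢ = contradiction refl r≢
  ... | no _     | no _  | yes _ = refl
  ... | no _     | no _  | no _  = refl
  ... | no _     | yes _ | no _  = refl
  ... | no i≢j   | yes q≡ | yes r≡ = contradiction
    (trans (sym (combine-remQuot {m} n i))
      (trans (cong₂ combine q≡ r≡) (combine-remQuot {m} n j))) i≢j

Orthogonal : Matrix n n → Set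
Orthogonal A = IsInverse A (A ᵀ)

⊗-orthogonal : (A : Matrix m m) (B : Matrix n n) →
               Orthogonal A → Orthogonal B → Orthogonal (A ⊗ B)
⊗-orthogonal {m} {n} A B (AAᵀ , AᵀA) (BBᵀ , BᵀB) =
  trans (⊗-*ᴹ-ᵀ A B A B) (trans (cong₂ _⊗_ AAᵀ BBᵀ) (𝟙⊗𝟙≡𝟙 {m} {n})) ,
  trans (cong (_*ᴹ (A ⊗ B)) (⊗-ᵀ A B))
    (trans (⊗-*ᴹ (A ᵀ) (B ᵀ) A B) (trans (cong₂ _⊗_ AᵀA BᵀB) (𝟙⊗𝟙≡𝟙 {m} {n})))

γ₁-orthogonal : ∀ a b → Orthogonal (γ₁ a b)
γ₁-orthogonal 0F 0F = refl , refl
γ₁-orthogonal 0F 1F = refl , refl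
γ₁-orthogonal 1F 0F = refl , refl
γ₁-orthogonal 1F 1F = refl , refl

γ-orthogonal : ∀ m .{{_ : NonZero m}} i → Orthogonal (γ m i)
γ-orthogonal 1             (a ∷ b ∷ []) = γ₁-orthogonal a b
γ-orthogonal (suc (suc m)) (a ∷ b ∷ i)  =
  ⊗-orthogonal (γ₁ a b) (γ (suc m) i) (γ₁-orthogonal a b) (γ-orthogonal (suc m) i)

-- Parity and support under Kronecker products.

-- Parity 1 means symmetric and -1 means skew. Expressed as a scalar, it is multiplicative under
-- `⊗`.
Parity : ℤ → Matrix n n → Set
Parity x A = ∀ i j → A ⟨ j , i ⟩ ≡ x * A ⟨ i , j ⟩

NonZeroEntry : Matrix m n → Set
NonZeroEntry A = ∃₂ λ i j → A ⟨ i , j ⟩ ≢ 0ℤ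

OverlappingSupport : Matrix m n → Matrix m n → Set
OverlappingSupport A B = ∃₂ λ i j → A ⟨ i , j ⟩ ≢ 0ℤ × B ⟨ i , j ⟩ ≢ 0ℤ

*-≢0 : ∀ {x y} → x ≢ 0ℤ → y ≢ 0ℤ → x * y ≢ 0ℤ
*-≢0 {x} x≢0 y≢0 xy≡0 with ℤ.i*j≡0⇒i≡0∨j≡0 x xy≡0
... | inj₁ x≡0 = x≢0 x≡0
... | inj₂ y≡0 = y≢0 y≡0

*-≢0⁻ : ∀ x y → x * y ≢ 0ℤ → x ≢ 0ℤ × y ≢ 0ℤ
*-≢0⁻ x y xy≢0 =
  (λ { refl → xy≢0 (ℤ.*-zeroˡ y) }) , (λ { refl → xy≢0 (ℤ.*-zeroʳ x) })

⊗-parity : ∀ x y (A : Matrix m m) (B : Matrix n n) →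
           Parity x A → Parity y B → Parity (x * y) (A ⊗ B)
⊗-parity {m} {n} x y A B A-parity B-parity i j = begin
  (A ⊗ B) ⟨ j , i ⟩
    ≡⟨ ⊗-lookup A B j i ⟩
  A ⟨ j₁ , i₁ ⟩ * B ⟨ j₂ , i₂ ⟩
    ≡⟨ cong₂ _*_ (A-parity i₁ j₁) (B-parity i₂ j₂) ⟩
  (x * A ⟨ i₁ , j₁ ⟩) * (y * B ⟨ i₂ , j₂ ⟩)
    ≡⟨ [ij][kl]≡[ik][jl] x _ y _ ⟩
  (x * y) * (A ⟨ i₁ , j₁ ⟩ * B ⟨ i₂ , j₂ ⟩)
    ≡⟨ cong ((x * y) *_) (⊗-lookup A B i j) ⟨
  (x * y) * (A ⊗ B) ⟨ i , j ⟩ ∎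
  where
  i₁ = quotient {m} n i
  i₂ = remainder {m} n i
  j₁ = quotient {m} n j
  j₂ = remainder {m} n j

⊗-nonZeroEntry : (A : Matrix m n) (B : Matrix p q) →
                 NonZeroEntry A → NonZeroEntry B → NonZeroEntry (A ⊗ B)
⊗-nonZeroEntry A B (i , j , Aij≢0) (k , l , Bkl≢0) =
  combine i k , combine j l ,
  subst (_≢ 0ℤ) (sym (⊗-lookup-combine A B i j k l)) (*-≢0 Aij≢0 Bkl≢0)

⊗-overlapping : (A C : Matrix m n) (B D : Matrix p q) →
                OverlappingSupport A C → OverlappingSupport B D →
                OverlappingSupport (A ⊗ B) (C ⊗ D)
⊗-overlapping A C B D (i , j , A≢0 , C≢0) (k , l , B≢0 , D≢0) =
  combine i k , combine j l ,
  subst (_≢ 0ℤ) (sym (⊗-lookup-combine A B i j k l)) (*-≢0 A≢0 B≢0) ,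
  subst (_≢ 0ℤ) (sym (⊗-lookup-combine C D i j k l)) (*-≢0 C≢0 D≢0)

⊗-≢0⁻ : (A : Matrix m n) (B : Matrix p q) → ∀ i j → (A ⊗ B) ⟨ i , j ⟩ ≢ 0ℤ →
        A ⟨ quotient p i , quotient q j ⟩ ≢ 0ℤ × B ⟨ remainder {m} p i , remainder {n} q j ⟩ ≢ 0ℤ
⊗-≢0⁻ A B i j = *-≢0⁻ _ _ ∘ subst (_≢ 0ℤ) (⊗-lookup A B i j)

⊗-disjointˡ : (A C : Matrix m n) (B D : Matrix p q) →
              DisjointSupport A C → DisjointSupport (A ⊗ B) (C ⊗ D)
⊗-disjointˡ A C B D A#C i j (AB≢0 , CD≢0) =
  A#C _ _ (proj₁ (⊗-≢0⁻ A B i j AB≢0) , proj₁ (⊗-≢0⁻ C D i j CD≢0))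

⊗-disjointʳ : (A C : Matrix m n) (B D : Matrix p q) →
              DisjointSupport B D → DisjointSupport (A ⊗ B) (C ⊗ D)
⊗-disjointʳ A C B D B#D i j (AB≢0 , CD≢0) =
  B#D _ _ (proj₂ (⊗-≢0⁻ A B i j AB≢0) , proj₂ (⊗-≢0⁻ C D i j CD≢0))

IsSign : ℤ → Set
IsSign x = x ≡ 1ℤ ⊎ x ≡ -1ℤ

*-isSign : ∀ {x y} → IsSign x → IsSign y → IsSign (x * y)
*-isSign (inj₁ refl) (inj₁ refl) = inj₁ refl
*-isSign (inj₁ refl) (inj₂ refl) = inj₂ refl
*-isSign (inj₂ refl) (inj₁ refl) = inj₂ refl
*-isSign (inj₂ refl) (inj₂ refl) = inj₁ refl

-- The invariant carried through the induction on Kronecker factors. The non-zero entry makes the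
-- parity `x` unique, as a zero matrix has every parity. A single overlapping position stands in for
-- equal supports, since it already refutes `DisjointSupport`; the accompanying `x ≡ 1ℤ` fixes the
-- weight of such pairs.
Related : ℤ → ℤ → Matrix n n → Matrix n n → Set
Related x z A B =
  Parity x (A *ᴹ B ᵀ) × NonZeroEntry (A *ᴹ B ᵀ) × IsSign x ×
  ((z ≡ 0ℤ × DisjointSupport A B) ⊎ (z ≡ 1ℤ × x ≡ 1ℤ × OverlappingSupport A B))

-- One pair of factors with disjoint supports makes the Kronecker products disjoint, just as one
-- zero makes `z * w` vanish. If both pairs overlap, so do the products, and the parity is 1 times
-- 1.
⊗-related : ∀ {x y z w} (A C : Matrix m m) (B D : Matrix n n) →
            Related x z A C → Related y w B D → Related (x * y) (z * w) (A ⊗ B) (C ⊗ D)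
⊗-related {x = x} {y} {z} {w} A C B D
  (AC-parity , AC≢0 , x-sign , AC-support) (BD-parity , BD≢0 , y-sign , BD-support) =
  subst (Parity (x * y)) (sym (⊗-*ᴹ-ᵀ A B C D))
    (⊗-parity x y (A *ᴹ C ᵀ) (B *ᴹ D ᵀ) AC-parity BD-parity) ,
  subst NonZeroEntry (sym (⊗-*ᴹ-ᵀ A B C D)) (⊗-nonZeroEntry (A *ᴹ C ᵀ) (B *ᴹ D ᵀ) AC≢0 BD≢0) ,
  *-isSign x-sign y-sign ,
  support AC-support BD-support
  where
  support : _ → _ → _
  support (inj₁ (refl , A#C)) _ = inj₁ (ℤ.*-zeroˡ w , ⊗-disjointˡ A C B D A#C)
  support (inj₂ _) (inj₁ (refl , B#D)) = inj₁ (ℤ.*-zeroʳ z , ⊗-disjointʳ A C B D B#D)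
  support (inj₂ (refl , refl , A∩C)) (inj₂ (refl , refl , B∩D)) =
    inj₂ (refl , refl , ⊗-overlapping A C B D A∩C B∩D)

-- Kernels on digits and their tensor powers.

Digit : Set
Digit = Fin 2 × Fin 2

Kernel : Set
Kernel = Digit → Digit → ℤ

allDigits? : {P : Digit → Set} → Decidable P → Dec (∀ d → P d)
allDigits? P? = map′ (λ f (a , b) → f a b) (λ f a b → f (a , b))
  (all? λ a → all? λ b → P? (a , b))

Index : ℕ → Set
Index m = Vec (Fin 2) (m ℕ.* 2)

infixr 5 _∷ᵈ_

_∷ᵈ_ : Digit → Index m → Index (suc m)
(a , b) ∷ᵈ i = a ∷ b ∷ i

-- The tensor power of the 4 × 4 matrix `K`, mirroring the recursion of `γ`. Unlike `γ` it starts at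
-- `m = 0`, which gives sums over indices a trivial base case.
⟦_⟧ : Kernel → ∀ m → Index m → Index m → ℤ
⟦ K ⟧ zero    []          []          = 1ℤ
⟦ K ⟧ (suc m) (a ∷ b ∷ i) (c ∷ d ∷ j) = K (a , b) (c , d) * ⟦ K ⟧ m i j

-- γ₁ d (γ₁ e)ᵀ = ± γ₁ (d + e), and E₁ = γ₁ 0 1 is the only skew matrix among the γ₁ d.
χ₁ : Kernel
χ₁ (a , b) (c , d) = if does (a ≟ c) ∧ not (does (b ≟ d)) then -1ℤ else 1ℤ

-- γ₁ a b is diagonal if a = b and has zero diagonal otherwise.
ζ₁ : Kernel
ζ₁ (a , b) (c , d) = if does (does (a ≟ b) Bool.≟ does (c ≟ d)) then 1ℤ else 0ℤ

χ ζ : ∀ m → Index m → Index m → ℤ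
χ = ⟦ χ₁ ⟧
ζ = ⟦ ζ₁ ⟧

related? : ∀ x z (A B : Matrix n n) → Dec (Related x z A B)
related? x z A B =
  (all? λ i → all? λ j → _ ℤ.≟ _) ×-dec
  (any? λ i → any? λ j → ¬? (_ ℤ.≟ _)) ×-dec
  (x ℤ.≟ 1ℤ ⊎-dec x ℤ.≟ -1ℤ) ×-dec
  ((z ℤ.≟ 0ℤ ×-dec all? λ i → all? λ j → ¬? (bothNonZero? i j)) ⊎-dec
   (z ℤ.≟ 1ℤ ×-dec x ℤ.≟ 1ℤ ×-dec any? λ i → any? λ j → bothNonZero? i j))
  where
  bothNonZero? : ∀ i j → Dec (A ⟨ i , j ⟩ ≢ 0ℤ × B ⟨ i , j ⟩ ≢ 0ℤ)
  bothNonZero? i j = ¬? (_ ℤ.≟ _) ×-dec ¬? (_ ℤ.≟ _)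

-- Sixteen pairs of explicit 2 × 2 matrices, settled by evaluating the decision procedure.
γ₁-related : ∀ d e → Related (χ₁ d e) (ζ₁ d e) (uncurry γ₁ d) (uncurry γ₁ e)
γ₁-related = from-yes (allDigits? λ d → allDigits? λ e →
  related? (χ₁ d e) (ζ₁ d e) (uncurry γ₁ d) (uncurry γ₁ e))

γ-related : ∀ m .{{_ : NonZero m}} i j → Related (χ m i j) (ζ m i j) (γ m i) (γ m j)
γ-related 1 (a ∷ b ∷ []) (c ∷ d ∷ []) =
  -- `⟦ K ⟧ 1` carries a trailing factor 1 from the empty index, whereas `γ 1` is `γ₁` itself.
  subst₂ (λ x z → Related x z (γ₁ a b) (γ₁ c d))
    (sym (ℤ.*-identityʳ _)) (sym (ℤ.*-identityʳ _)) (γ₁-related (a , b) (c , d))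
γ-related (suc (suc m)) (a ∷ b ∷ i) (c ∷ d ∷ j) =
  ⊗-related (γ₁ a b) (γ₁ c d) (γ (suc m) i) (γ (suc m) j)
    (γ₁-related (a , b) (c , d)) (γ-related (suc m) i j)

-- Sums over all indices.

sumOver : List X → (X → ℤ) → ℤ
sumOver xs f = foldr (λ x s → f x + s) 0ℤ xs

sumOver-cong : ∀ (xs : List X) {f g} → (∀ x → f x ≡ g x) → sumOver xs f ≡ sumOver xs g
sumOver-cong []       f≗g = refl
sumOver-cong (x ∷ xs) f≗g = cong₂ _+_ (f≗g x) (sumOver-cong xs f≗g)

sumOver-++ : ∀ (xs ys : List X) f → sumOver (xs ++ ys) f ≡ sumOver xs f + sumOver ys f
sumOver-++ []       ys f = sym (ℤ.+-identityˡ _)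
sumOver-++ (x ∷ xs) ys f =
  trans (cong (_+_ (f x)) (sumOver-++ xs ys f)) (sym (ℤ.+-assoc (f x) _ _))

-- Three terms with leading coefficient 1: the shape of an edge weight and of its product with
-- another function.
sumOver-linear : ∀ (xs : List X) (f g h : X → ℤ) a b →
                 sumOver xs (λ x → f x + a * g x + b * h x) ≡
                 sumOver xs f + a * sumOver xs g + b * sumOver xs h
sumOver-linear [] f g h a b =
  solve 2 (λ a b → con 0ℤ := con 0ℤ :+ a :* con 0ℤ :+ b :* con 0ℤ) refl a b
  where open +-*-Solver
sumOver-linear (x ∷ xs) f g h a b =
  trans (cong (_+_ (f x + a * g x + b * h x)) (sumOver-linear xs f g h a b))
  (solve 8 (λ u v w s t r a b →
     (u :+ a :* v :+ b :* w) :+ (s :+ a :* t :+ b :* r) :=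
     (u :+ s) :+ a :* (v :+ t) :+ b :* (w :+ r)) refl
     (f x) (g x) (h x) (sumOver xs f) (sumOver xs g) (sumOver xs h) a b)
  where open +-*-Solver

sumOver-map : ∀ (k : X → Y) (xs : List X) f → sumOver (map k xs) f ≡ sumOver xs (f ∘ k)
sumOver-map k []       f = refl
sumOver-map k (x ∷ xs) f = cong (_+_ (f (k x))) (sumOver-map k xs f)

sumOver-*ˡ : ∀ (xs : List X) a f → sumOver xs (λ x → a * f x) ≡ a * sumOver xs f
sumOver-*ˡ []       a f = sym (ℤ.*-zeroʳ a)
sumOver-*ˡ (x ∷ xs) a f =
  trans (cong (_+_ (a * f x)) (sumOver-*ˡ xs a f)) (sym (ℤ.*-distribˡ-+ a (f x) _))

sumOver-product : ∀ (xs : List X) (ys : List Y) (p : X → Y → Z) f g h →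
                  (∀ x y → f (p x y) ≡ g x * h y) →
                  sumOver (cartesianProductWith p xs ys) f ≡ sumOver xs g * sumOver ys h
sumOver-product []       ys p f g h eq = refl
sumOver-product (x ∷ xs) ys p f g h eq = begin
  sumOver (map (p x) ys ++ cartesianProductWith p xs ys) f
    ≡⟨ sumOver-++ (map (p x) ys) _ f ⟩
  sumOver (map (p x) ys) f + sumOver (cartesianProductWith p xs ys) f
    ≡⟨ cong₂ _+_ (sumOver-map (p x) ys f) (sumOver-product xs ys p f g h eq) ⟩
  sumOver ys (f ∘ p x) + sumOver xs g * sumOver ys h
    ≡⟨ cong (λ z → z + sumOver xs g * sumOver ys h)
         (trans (sumOver-cong ys {f ∘ p x} (eq x)) (sumOver-*ˡ ys (g x) h)) ⟩
  g x * sumOver ys h + sumOver xs g * sumOver ys h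
    ≡⟨ ℤ.*-distribʳ-+ (sumOver ys h) (g x) _ ⟨
  (g x + sumOver xs g) * sumOver ys h ∎

digits : List Digit
digits = cartesianProduct (allFin 2) (allFin 2)

indices : ∀ m → List (Index m)
indices zero    = [] ∷ []
indices (suc m) = cartesianProductWith (_∷ᵈ_ {m}) digits (indices m)

∈-indices : ∀ m (i : Index m) → i ∈ indices m
∈-indices zero    []          = here refl
∈-indices (suc m) (a ∷ b ∷ i) = ∈-cartesianProductWith⁺ (_∷ᵈ_ {m})
  (∈-cartesianProduct⁺ (∈-allFin a) (∈-allFin b)) (∈-indices m i)

indices-unique : ∀ m → Unique (indices m)
indices-unique zero    = All.[] ∷ []
indices-unique (suc m) = cartesianProductWith⁺ (_∷ᵈ_ {m}) (λ { refl → refl , refl })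
  (cartesianProduct⁺ (allFin⁺ 2) (allFin⁺ 2)) (indices-unique m)

-- In matrix terms, `K Lᵀ = t N` passes to tensor powers. The sum over the first digit separates
-- from the sum over the rest, so a table of 16 digit pairs decides every `m`.
⟦⟧-sum : ∀ (K L N : Kernel) t →
         (∀ d e → sumOver digits (λ f → K d f * L e f) ≡ + t * N d e) →
         ∀ m (i j : Index m) →
         sumOver (indices m) (λ k → ⟦ K ⟧ m i k * ⟦ L ⟧ m j k) ≡ + (t ^ m) * ⟦ N ⟧ m i j
⟦⟧-sum K L N t eq zero    []          []            = refl
⟦⟧-sum K L N t eq (suc m) (a ∷ b ∷ i) (a′ ∷ b′ ∷ j) = begin
  sumOver (indices (suc m)) f
    ≡⟨ sumOver-product digits (indices m) (_∷ᵈ_ {m})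
         f (λ d → K (a , b) d * L (a′ , b′) d) (λ k → ⟦ K ⟧ m i k * ⟦ L ⟧ m j k) (λ d k →
         [ij][kl]≡[ik][jl] (K (a , b) d) (⟦ K ⟧ m i k) (L (a′ , b′) d) (⟦ L ⟧ m j k)) ⟩
  sumOver digits (λ d → K (a , b) d * L (a′ , b′) d) *
  sumOver (indices m) (λ k → ⟦ K ⟧ m i k * ⟦ L ⟧ m j k)
    ≡⟨ cong₂ _*_ (eq (a , b) (a′ , b′)) (⟦⟧-sum K L N t eq m i j) ⟩
  (+ t * N (a , b) (a′ , b′)) * (+ (t ^ m) * ⟦ N ⟧ m i j)
    ≡⟨ [ij][kl]≡[ik][jl] (+ t) _ (+ (t ^ m)) _ ⟩
  (+ t * + (t ^ m)) * (N (a , b) (a′ , b′) * ⟦ N ⟧ m i j)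
    ≡⟨ cong (_* (N (a , b) (a′ , b′) * ⟦ N ⟧ m i j)) (ℤ.pos-* t (t ^ m)) ⟨
  + (t ^ suc m) * (N (a , b) (a′ , b′) * ⟦ N ⟧ m i j) ∎
  where
  f : Index (suc m) → ℤ
  f k = ⟦ K ⟧ (suc m) (a ∷ b ∷ i) k * ⟦ L ⟧ (suc m) (a′ ∷ b′ ∷ j) k

⟦⟧-sym : ∀ (K : Kernel) → (∀ d e → K d e ≡ K e d) →
         ∀ m (i j : Index m) → ⟦ K ⟧ m i j ≡ ⟦ K ⟧ m j i
⟦⟧-sym K K-sym zero    []          []          = refl
⟦⟧-sym K K-sym (suc m) (a ∷ b ∷ i) (c ∷ d ∷ j) =
  cong₂ _*_ (K-sym (a , b) (c , d)) (⟦⟧-sym K K-sym m i j)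

⟦⟧-diagonal : ∀ (K : Kernel) → (∀ d → K d d ≡ 1ℤ) → ∀ m (i : Index m) → ⟦ K ⟧ m i i ≡ 1ℤ
⟦⟧-diagonal K K-diag zero    []          = refl
⟦⟧-diagonal K K-diag (suc m) (a ∷ b ∷ i) =
  cong₂ _*_ (K-diag (a , b)) (⟦⟧-diagonal K K-diag m i)

𝟏₁ : Kernel
𝟏₁ _ _ = 1ℤ

⟦𝟏₁⟧ : ∀ m (i j : Index m) → ⟦ 𝟏₁ ⟧ m i j ≡ 1ℤ
⟦𝟏₁⟧ zero    []          []          = refl
⟦𝟏₁⟧ (suc m) (_ ∷ _ ∷ i) (_ ∷ _ ∷ j) = cong (1ℤ *_) (⟦𝟏₁⟧ m i j)

δ₁ : Kernel
δ₁ (a , b) (c , d) = if does (a ≟ c) ∧ does (b ≟ d) then 1ℤ else 0ℤ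

⟦δ₁⟧-≢ : ∀ m (i j : Index m) → i ≢ j → ⟦ δ₁ ⟧ m i j ≡ 0ℤ
⟦δ₁⟧-≢ zero    []          []          i≢j = contradiction refl i≢j
⟦δ₁⟧-≢ (suc m) (a ∷ b ∷ i) (c ∷ d ∷ j) i≢j with a ≟ c | b ≟ d
... | no _     | _        = ℤ.*-zeroˡ (⟦ δ₁ ⟧ m i j)
... | yes refl | no _     = ℤ.*-zeroˡ (⟦ δ₁ ⟧ m i j)
... | yes refl | yes refl = trans (ℤ.*-identityˡ _) (⟦δ₁⟧-≢ m i j (i≢j ∘ cong (λ k → a ∷ b ∷ k)))

sumDigits? : ∀ (K L N : Kernel) t →
             Dec (∀ d e → sumOver digits (λ f → K d f * L e f) ≡ + t * N d e)
sumDigits? K L N t = allDigits? λ d → allDigits? λ e → _ ℤ.≟ _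

module _ (m : ℕ) (i j : Index m) where

  -- `χ₁` is a symmetric Hadamard matrix of order 4, so its tensor power is a Hadamard matrix of
  -- order `4 ^ m`.
  χχ-sum : sumOver (indices m) (λ k → χ m i k * χ m j k) ≡ + (4 ^ m) * ⟦ δ₁ ⟧ m i j
  χχ-sum = ⟦⟧-sum χ₁ χ₁ δ₁ 4 (from-yes (sumDigits? χ₁ χ₁ δ₁ 4)) m i j

  -- The columns of `ζ₁` are eigenvectors of `χ₁` with eigenvalue 2.
  χζ-sum : sumOver (indices m) (λ k → χ m i k * ζ m j k) ≡ + (2 ^ m) * ζ m i j
  χζ-sum = ⟦⟧-sum χ₁ ζ₁ ζ₁ 2 (from-yes (sumDigits? χ₁ ζ₁ ζ₁ 2)) m i j

  ζχ-sum : sumOver (indices m) (λ k → ζ m i k * χ m j k) ≡ + (2 ^ m) * ζ m i j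
  ζχ-sum = ⟦⟧-sum ζ₁ χ₁ ζ₁ 2 (from-yes (sumDigits? ζ₁ χ₁ ζ₁ 2)) m i j

  ζζ-sum : sumOver (indices m) (λ k → ζ m i k * ζ m j k) ≡ + (2 ^ m) * ζ m i j
  ζζ-sum = ⟦⟧-sum ζ₁ ζ₁ ζ₁ 2 (from-yes (sumDigits? ζ₁ ζ₁ ζ₁ 2)) m i j

-- A row sum is a sum of products whose second kernel is constantly 1.
⟦⟧-total : ∀ (K : Kernel) t → (∀ d e → sumOver digits (λ f → K d f * 𝟏₁ e f) ≡ + t * 𝟏₁ d e) →
           ∀ m (i : Index m) → sumOver (indices m) (⟦ K ⟧ m i) ≡ + (t ^ m)
⟦⟧-total K t eq m i = begin
  sumOver (indices m) (⟦ K ⟧ m i)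
    ≡⟨ sumOver-cong (indices m) {g = ⟦ K ⟧ m i} (λ k →
         trans (cong (⟦ K ⟧ m i k *_) (⟦𝟏₁⟧ m i k)) (ℤ.*-identityʳ _)) ⟨
  sumOver (indices m) (λ k → ⟦ K ⟧ m i k * ⟦ 𝟏₁ ⟧ m i k)
    ≡⟨ ⟦⟧-sum K 𝟏₁ 𝟏₁ t eq m i i ⟩
  + (t ^ m) * ⟦ 𝟏₁ ⟧ m i i
    ≡⟨ trans (cong (+ (t ^ m) *_) (⟦𝟏₁⟧ m i i)) (ℤ.*-identityʳ _) ⟩
  + (t ^ m) ∎

χ-sum : ∀ m i → sumOver (indices m) (χ m i) ≡ + (2 ^ m)
χ-sum = ⟦⟧-total χ₁ 2 (from-yes (sumDigits? χ₁ 𝟏₁ 𝟏₁ 2))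

ζ-sum : ∀ m i → sumOver (indices m) (ζ m i) ≡ + (2 ^ m)
ζ-sum = ⟦⟧-total ζ₁ 2 (from-yes (sumDigits? ζ₁ 𝟏₁ 𝟏₁ 2))

1-sum : ∀ m → sumOver (indices m) (λ _ → 1ℤ) ≡ + (4 ^ m)
-- The all-zero index is an arbitrary choice of row: `⟦ 𝟏₁ ⟧` is 1 everywhere.
1-sum m = trans (sumOver-cong (indices m) λ k → sym (⟦𝟏₁⟧ m (Vec.replicate _ 0F) k))
  (⟦⟧-total 𝟏₁ 4 (from-yes (sumDigits? 𝟏₁ 𝟏₁ 𝟏₁ 4)) m (Vec.replicate _ 0F))

χ-sym : ∀ m i j → χ m i j ≡ χ m j i
χ-sym = ⟦⟧-sym χ₁ (from-yes (allDigits? λ d → allDigits? λ e → χ₁ d e ℤ.≟ χ₁ e d))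

ζ-sym : ∀ m i j → ζ m i j ≡ ζ m j i
ζ-sym = ⟦⟧-sym ζ₁ (from-yes (allDigits? λ d → allDigits? λ e → ζ₁ d e ℤ.≟ ζ₁ e d))

χ-diagonal : ∀ m i → χ m i i ≡ 1ℤ
χ-diagonal = ⟦⟧-diagonal χ₁ (from-yes (allDigits? λ d → χ₁ d d ℤ.≟ 1ℤ))

ζ-diagonal : ∀ m i → ζ m i i ≡ 1ℤ
ζ-diagonal = ⟦⟧-diagonal ζ₁ (from-yes (allDigits? λ d → ζ₁ d d ℤ.≟ 1ℤ))

-- Edge weights, their sums and the sums of their products.

-- `colourSign` is the parity that an edge of the colour demands. Overlapping pairs have `χ = 1`, so
-- `1 - χ` already excludes them from red, while for blue `1 + χ` is 2 there and must be lowered by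
-- 2.
colourSign ζ-coefficient : Colour → ℤ
colourSign red  = -1ℤ
colourSign blue = 1ℤ
ζ-coefficient red  = 0ℤ
ζ-coefficient blue = - (+ 2)

-- Twice the indicator of an edge of the given colour.
weight : Colour → ℤ → ℤ → ℤ
weight c x z = 1ℤ + colourSign c * x + ζ-coefficient c * z

edgeWeight : Colour → ∀ m → Index m → Index m → ℤ
edgeWeight c m i j = weight c (χ m i j) (ζ m i j)

-- Both colours agree because `colourSign c + ζ-coefficient c` is -1 for each, and `χ` and `ζ` have
-- the same row sum.
weight-sum : ∀ c m i → sumOver (indices m) (edgeWeight c m i) ≡ + (4 ^ m) - + (2 ^ m)
weight-sum c m i = begin
  sumOver (indices m) (edgeWeight c m i)
    ≡⟨ sumOver-linear (indices m) (λ _ → 1ℤ) (χ m i) (ζ m i) (colourSign c) (ζ-coefficient c) ⟩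
  sumOver (indices m) (λ _ → 1ℤ) + colourSign c * sumOver (indices m) (χ m i)
    + ζ-coefficient c * sumOver (indices m) (ζ m i)
    ≡⟨ cong₂ _+_ (cong₂ _+_ (1-sum m) (cong (colourSign c *_) (χ-sum m i)))
         (cong (ζ-coefficient c *_) (ζ-sum m i)) ⟩
  + (4 ^ m) + colourSign c * + (2 ^ m) + ζ-coefficient c * + (2 ^ m)
    ≡⟨ simplify c (+ (4 ^ m)) (+ (2 ^ m)) ⟩
  + (4 ^ m) - + (2 ^ m) ∎
  where
  open +-*-Solver
  simplify : ∀ c q p → q + colourSign c * p + ζ-coefficient c * p ≡ q - p
  simplify red  = solve 2 (λ q p → q :+ con -1ℤ :* p :+ con 0ℤ :* p := q :- p) refl
  simplify blue = solve 2 (λ q p → q :+ con 1ℤ :* p :+ con (- (+ 2)) :* p := q :- p) refl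

-- With `a` and `b` the two coefficients, the `χχ` sum vanishes for distinct indices, and `ζ m i j`
-- enters only with the factor `b (2 a + b)`. This is 0 for red, where `b = 0`, and for blue, where
-- `b = -2 a`. Hence the result does not see whether `i` and `j` are joined, which is why λ = μ.
weight-product-sum : ∀ c m i j → i ≢ j →
  sumOver (indices m) (λ k → edgeWeight c m i k * edgeWeight c m j k) ≡ + (4 ^ m) - + 2 * + (2 ^ m)
weight-product-sum c m i j i≢j = begin
  sumOver (indices m) (λ k → w i k * w j k)
    ≡⟨ sumOver-cong (indices m) (λ k → distribute (χ m i k) (ζ m i k) (w j k)) ⟩
  sumOver (indices m) (λ k → w j k + a * (χ m i k * w j k) + b * (ζ m i k * w j k))
    ≡⟨ sumOver-linear (indices m) (w j) (λ k → χ m i k * w j k) (λ k → ζ m i k * w j k) a b ⟩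
  sumOver (indices m) (w j) + a * sumOver (indices m) (λ k → χ m i k * w j k)
    + b * sumOver (indices m) (λ k → ζ m i k * w j k)
    ≡⟨ cong₂ (λ s t → sumOver (indices m) (w j) + a * s + b * t)
         (expand (χ m i)) (expand (ζ m i)) ⟩
  sumOver (indices m) (w j)
    + a * (sumOver (indices m) (χ m i) + a * sumOver (indices m) (λ k → χ m i k * χ m j k)
             + b * sumOver (indices m) (λ k → χ m i k * ζ m j k))
    + b * (sumOver (indices m) (ζ m i) + a * sumOver (indices m) (λ k → ζ m i k * χ m j k)
             + b * sumOver (indices m) (λ k → ζ m i k * ζ m j k))
    ≡⟨ cong₂ _+_ (cong₂ _+_ (weight-sum c m j) (cong (a *_) (cong₂ _+_ (cong₂ _+_ (χ-sum m i)
           (cong (a *_) (trans (χχ-sum m i j) (trans (cong (4ᵐ *_) (⟦δ₁⟧-≢ m i j i≢j)) (ℤ.*-zeroʳ 4ᵐ)))))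
           (cong (b *_) (χζ-sum m i j)))))
         (cong (b *_) (cong₂ _+_ (cong₂ _+_ (ζ-sum m i)
           (cong (a *_) (ζχ-sum m i j))) (cong (b *_) (ζζ-sum m i j)))) ⟩
  (4ᵐ - 2ᵐ) + a * (2ᵐ + a * 0ℤ + b * (2ᵐ * ζ m i j))
    + b * (2ᵐ + a * (2ᵐ * ζ m i j) + b * (2ᵐ * ζ m i j))
    ≡⟨ simplify c 4ᵐ 2ᵐ (2ᵐ * ζ m i j) ⟩
  4ᵐ - + 2 * 2ᵐ ∎
  where
  open +-*-Solver
  a = colourSign c
  b = ζ-coefficient c
  2ᵐ = + (2 ^ m)
  4ᵐ = + (4 ^ m)
  w = edgeWeight c m
  distribute : ∀ x z y → (1ℤ + a * x + b * z) * y ≡ y + a * (x * y) + b * (z * y)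
  distribute x z y = solve 5 (λ a b x z y →
    (con 1ℤ :+ a :* x :+ b :* z) :* y := y :+ a :* (x :* y) :+ b :* (z :* y)) refl a b x z y
  expand : ∀ f → sumOver (indices m) (λ k → f k * w j k) ≡
           sumOver (indices m) f + a * sumOver (indices m) (λ k → f k * χ m j k)
             + b * sumOver (indices m) (λ k → f k * ζ m j k)
  expand f = trans
    (sumOver-cong (indices m) λ k → solve 5 (λ a b x z y →
      y :* (con 1ℤ :+ a :* x :+ b :* z) := y :+ a :* (y :* x) :+ b :* (y :* z)) refl
      a b (χ m j k) (ζ m j k) (f k))
    (sumOver-linear (indices m) f _ _ a b)
  -- This fails for free `a` and `b`, so the solver is given the constants of each colour.
  simplify : ∀ c q p z → let a = colourSign c; b = ζ-coefficient c in
    (q - p) + a * (p + a * 0ℤ + b * z) + b * (p + a * z + b * z) ≡ q - + 2 * p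
  simplify red  = solve 3 (λ q p z →
    (q :- p) :+ con -1ℤ :* (p :+ con -1ℤ :* con 0ℤ :+ con 0ℤ :* z)
      :+ con 0ℤ :* (p :+ con -1ℤ :* z :+ con 0ℤ :* z) := q :- con (+ 2) :* p) refl
  simplify blue = solve 3 (λ q p z →
    (q :- p) :+ con 1ℤ :* (p :+ con 1ℤ :* con 0ℤ :+ con (- (+ 2)) :* z)
      :+ con (- (+ 2)) :* (p :+ con 1ℤ :* z :+ con (- (+ 2)) :* z) := q :- con (+ 2) :* p) refl

-- From edges to weights.

parity-unique : ∀ {x y} (A : Matrix n n) → NonZeroEntry A → Parity x A → Parity y A → x ≡ y
parity-unique {x = x} {y} A (i , j , Aij≢0) x-parity y-parity =
  ℤ.*-cancelʳ-≡ x y (A ⟨ i , j ⟩) {{≢-nonZero Aij≢0}}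
    (trans (sym (x-parity i j)) (y-parity i j))

skew⇒parity : (A : Matrix n n) → Skew A → Parity -1ℤ A
skew⇒parity A A-skew i j = trans (A-skew i j) (sym (ℤ.-1*i≡-i _))

parity⇒skew : (A : Matrix n n) → Parity -1ℤ A → Skew A
parity⇒skew A A-parity i j = trans (A-parity i j) (ℤ.-1*i≡-i _)

symmetric⇒parity : (A : Matrix n n) → Symmetric A → Parity 1ℤ A
symmetric⇒parity A A-sym i j = trans (A-sym i j) (sym (ℤ.*-identityˡ _))

parity⇒symmetric : (A : Matrix n n) → Parity 1ℤ A → Symmetric A
parity⇒symmetric A A-parity i j = trans (A-parity i j) (ℤ.*-identityˡ _)

-- `f` is `t` times the indicator of `P`, and the disjunction also decides `P`. The scale `t` avoids
-- halves and quarters in ℤ.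
WeighedBy : ℤ → ℤ → Set → Set
WeighedBy t f P = (P × f ≡ t) ⊎ (¬ P × f ≡ 0ℤ)

edge⇒parity : ∀ c (A B : Matrix n n) → Orthogonal B → Edge c A B → Parity (colourSign c) (A *ᴹ B ᵀ)
edge⇒parity red A B B-orthogonal (_ , C , B-C , AC-skew) =
  skew⇒parity (A *ᴹ B ᵀ)
    (subst (λ D → Skew (A *ᴹ D)) (inverse-unique {A = B} {C} {B ᵀ} B-C B-orthogonal) AC-skew)
edge⇒parity blue A B B-orthogonal (_ , C , B-C , AC-symmetric) =
  symmetric⇒parity (A *ᴹ B ᵀ)
    (subst (λ D → Symmetric (A *ᴹ D)) (inverse-unique {A = B} {C} {B ᵀ} B-C B-orthogonal) AC-symmetric)

parity⇒edge : ∀ c (A B : Matrix n n) → Orthogonal B → DisjointSupport A B →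
              Parity (colourSign c) (A *ᴹ B ᵀ) → Edge c A B
parity⇒edge red  A B B-orthogonal A#B p = A#B , B ᵀ , B-orthogonal , parity⇒skew (A *ᴹ B ᵀ) p
parity⇒edge blue A B B-orthogonal A#B p = A#B , B ᵀ , B-orthogonal , parity⇒symmetric (A *ᴹ B ᵀ) p

edge⇒disjoint : ∀ c (A B : Matrix n n) → Edge c A B → DisjointSupport A B
edge⇒disjoint red  A B = proj₁
edge⇒disjoint blue A B = proj₁

weight-≡ : ∀ c → weight c (colourSign c) 0ℤ ≡ + 2
weight-≡ red  = refl
weight-≡ blue = refl

weight-≢ : ∀ c {x} → IsSign x → x ≢ colourSign c → weight c x 0ℤ ≡ 0ℤ
weight-≢ red  (inj₁ refl) _   = refl
weight-≢ red  (inj₂ refl) x≢s = contradiction refl x≢s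
weight-≢ blue (inj₁ refl) x≢s = contradiction refl x≢s
weight-≢ blue (inj₂ refl) _   = refl

weight-1-1 : ∀ c → weight c 1ℤ 1ℤ ≡ 0ℤ
weight-1-1 red  = refl
weight-1-1 blue = refl

-- Overlap excludes an edge and gives weight `1 + a + b = 0`, where `a` and `b` are the coefficients
-- of the colour. For disjoint supports, the unique parity of `A Bᵀ` either is the sign of the
-- colour, giving weight 2, or its opposite, giving 0.
edge-weighedBy : ∀ c {x z} (A B : Matrix n n) → Related x z A B → Orthogonal B →
                 WeighedBy (+ 2) (weight c x z) (Edge c A B)
edge-weighedBy c A B (_ , _ , _ , inj₂ (refl , refl , i , j , A≢0 , B≢0)) _ =
  inj₂ ((λ edge → edge⇒disjoint c A B edge i j (A≢0 , B≢0)) , weight-1-1 c)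
edge-weighedBy c {x} A B (parity , M≢0 , x-sign , inj₁ (refl , A#B)) B-orthogonal
  with x ℤ.≟ colourSign c
... | yes refl = inj₁ (parity⇒edge c A B B-orthogonal A#B parity , weight-≡ c)
... | no x≢s   = inj₂
  ( (λ edge → x≢s (parity-unique (A *ᴹ B ᵀ) M≢0 parity (edge⇒parity c A B B-orthogonal edge)))
  , weight-≢ c x-sign x≢s )

weighedBy-× : ∀ {t f u g} {P Q : Set} → WeighedBy t f P → WeighedBy u g Q →
              WeighedBy (t * u) (f * g) (P × Q)
weighedBy-× (inj₁ (p , refl))  (inj₁ (q , refl))  = inj₁ ((p , q) , refl)
weighedBy-× {f = f} (inj₁ (_ , refl)) (inj₂ (¬q , refl)) = inj₂ (¬q ∘ proj₂ , ℤ.*-zeroʳ f)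
weighedBy-× {g = g} (inj₂ (¬p , refl)) _                 = inj₂ (¬p ∘ proj₁ , ℤ.*-zeroˡ g)

weighedBy⇒dec : ∀ {t f} {P : Set} → WeighedBy t f P → Dec P
weighedBy⇒dec (inj₁ (p , _))  = yes p
weighedBy⇒dec (inj₂ (¬p , _)) = no ¬p

-- The passage from sums to cardinalities.
sumOver-weighed : ∀ {P : Pred X 0ℓ} (P? : Decidable P) t f → (∀ x → WeighedBy t (f x) (P x)) →
                  ∀ xs → sumOver xs f ≡ t * + length (filter P? xs)
sumOver-weighed P? t f P-f []       = sym (ℤ.*-zeroʳ t)
sumOver-weighed P? t f P-f (x ∷ xs) with P-f x
... | inj₁ (Px , fx≡t) rewrite filter-accept P? {x} {xs} Px = begin
  f x + sumOver xs f                       ≡⟨ cong₂ _+_ fx≡t (sumOver-weighed P? t f P-f xs) ⟩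
  t + t * + length (filter P? xs)          ≡⟨ ℤ.*-suc t (+ length (filter P? xs)) ⟨
  t * + suc (length (filter P? xs))        ∎
... | inj₂ (¬Px , fx≡0) rewrite filter-reject P? {x} {xs} ¬Px =
  trans (cong₂ _+_ fx≡0 (sumOver-weighed P? t f P-f xs)) (ℤ.+-identityˡ _)

-- Counting vertices, neighbours and common neighbours.

module _ (m : ℕ) .{{m≢0 : NonZero m}} where

  -- `χ m i k` is the only parity of `γ m i *ᴹ γ m k ᵀ`, so it depends on `i` only through the
  -- matrix `γ m i`.
  γ-χ-cong : ∀ i j k → γ m i ≡ γ m j → χ m i k ≡ χ m j k
  γ-χ-cong i j k γi≡γj with γ-related m i k | γ-related m j k
  ... | i-parity , i≢0 , _ | j-parity , _ = parity-unique (γ m i *ᴹ γ m k ᵀ) i≢0 i-parity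
    (subst (λ A → Parity (χ m j k) (A *ᴹ γ m k ᵀ)) (sym γi≡γj) j-parity)

  -- χ m i and χ m j are orthogonal for i ≢ j, whereas γ m i ≡ γ m j makes them equal.
  γ-injective : ∀ {i j} → γ m i ≡ γ m j → i ≡ j
  γ-injective {i} {j} γi≡γj with Vec.≡-dec _≟_ i j
  ... | yes i≡j = i≡j
  ... | no  i≢j = contradiction (begin
    + (4 ^ m)                                         ≡⟨ ℤ.*-identityʳ (+ (4 ^ m)) ⟨
    + (4 ^ m) * 1ℤ                                    ≡⟨ cong (+ (4 ^ m) *_) (⟦⟧-diagonal δ₁ δ₁-diagonal m i) ⟨
    + (4 ^ m) * ⟦ δ₁ ⟧ m i i                          ≡⟨ χχ-sum m i i ⟨
    sumOver (indices m) (λ k → χ m i k * χ m i k)     ≡⟨ sumOver-cong (indices m) (λ k →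
                                                           cong (χ m i k *_) (γ-χ-cong i j k γi≡γj)) ⟩
    sumOver (indices m) (λ k → χ m i k * χ m j k)     ≡⟨ χχ-sum m i j ⟩
    + (4 ^ m) * ⟦ δ₁ ⟧ m i j                          ≡⟨ cong (+ (4 ^ m) *_) (⟦δ₁⟧-≢ m i j i≢j) ⟩
    + (4 ^ m) * 0ℤ                                    ≡⟨ ℤ.*-zeroʳ (+ (4 ^ m)) ⟩
    0ℤ                                                ∎)
    (ℕ.≢-nonZero⁻¹ (4 ^ m) {{ℕ.m^n≢0 4 m}} ∘ ℤ.+-injective)
    where
    δ₁-diagonal : ∀ d → δ₁ d d ≡ 1ℤ
    δ₁-diagonal = from-yes (allDigits? λ d → δ₁ d d ℤ.≟ 1ℤ)

  -- The enumeration is the image under `γ m` of the indices that satisfy `P`; injectivity of `γ m`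
  -- rules out repetitions. Cancelling `t` from the two values of the sum yields the length.
  hasSize-γ : ∀ {P : Pred (Matrix (2 ^ m) (2 ^ m)) 0ℓ} t .{{_ : ℤ.NonZero t}} f {n} →
              (∀ {A} → P A → CanonicalBasisMatrix m A) →
              (∀ i → WeighedBy t (f i) (P (γ m i))) →
              sumOver (indices m) f ≡ t * + n → HasSize P n
  hasSize-γ {P} t f {n} P⊆γ P-f sum≡tn =
    map (γ m) selected ,
    map⁺ γ-injective (filter⁺ P? (indices-unique m)) ,
    (λ A → mk⇔ sound complete) ,
    trans (length-map (γ m) selected)
      (ℤ.+-injective (ℤ.*-cancelˡ-≡ t _ _
        (trans (sym (sumOver-weighed P? t f P-f (indices m))) sum≡tn)))
    where
    P? : Decidable (P ∘ γ m)
    P? i = weighedBy⇒dec (P-f i)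

    selected : List (Index m)
    selected = filter P? (indices m)

    sound : ∀ {A} → A ∈ map (γ m) selected → P A
    sound A∈ with ∈-map⁻ (γ m) A∈
    ... | i , i∈ , refl = proj₂ (∈-filter⁻ P? {xs = indices m} i∈)

    complete : ∀ {A} → P A → A ∈ map (γ m) selected
    complete PA with P⊆γ PA
    ... | i , refl = ∈-map⁺ (γ m) (∈-filter⁺ P? (∈-indices m i) PA)

  edge-weighed : ∀ c i j → WeighedBy (+ 2) (edgeWeight c m i j) (Edge c (γ m i) (γ m j))
  edge-weighed c i j = edge-weighedBy c (γ m i) (γ m j) (γ-related m i j) (γ-orthogonal m j)

  edge⇒weight : ∀ c i j → Edge c (γ m i) (γ m j) → edgeWeight c m i j ≡ + 2
  edge⇒weight c i j edge with edge-weighed c i j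
  ... | inj₁ (_ , w≡2)     = w≡2
  ... | inj₂ (no-edge , _) = contradiction edge no-edge

  weight⇒edge : ∀ c i j → edgeWeight c m i j ≡ + 2 → Edge c (γ m i) (γ m j)
  weight⇒edge c i j w≡2 with edge-weighed c i j
  ... | inj₁ (edge , _) = edge
  ... | inj₂ (_ , w≡0) with () ← trans (sym w≡2) w≡0

  edge-irreflexive : ∀ c i → ¬ Edge c (γ m i) (γ m i)
  edge-irreflexive c i edge with () ← trans (sym (edge⇒weight c i i edge))
    (trans (cong₂ (weight c) (χ-diagonal m i) (ζ-diagonal m i)) (weight-1-1 c))

  -- Weight 2 characterises edges, and both kernels in the weight are symmetric.
  edge-symmetric : ∀ c i j → Edge c (γ m i) (γ m j) → Edge c (γ m j) (γ m i)
  edge-symmetric c i j edge = weight⇒edge c j i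
    (trans (cong₂ (weight c) (χ-sym m j i) (ζ-sym m j i)) (edge⇒weight c i j edge))

  Δ-isSimple : ∀ c → IsSimple (Δ m [ c ])
  Δ-isSimple c = record
    { irreflexive = λ { (i , refl) → edge-irreflexive c i }
    ; symmetric   = λ { (i , refl) (j , refl) → edge-symmetric c i j }
    }

  -- A constant weight 1 supplies the `Vertex` component of neighbours without changing the sums.
  vertex-weighed : ∀ i → WeighedBy 1ℤ 1ℤ (CanonicalBasisMatrix m (γ m i))
  vertex-weighed i = inj₁ ((i , refl) , refl)

  Δ-order : ∀ c → HasSize (Graph.Vertex (Δ m [ c ])) (4 ^ m)
  Δ-order c = hasSize-γ 1ℤ (λ _ → 1ℤ) id vertex-weighed
    (trans (1-sum m) (sym (ℤ.*-identityˡ _)))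

  Δ-degree : ∀ c i {n} → + (4 ^ m) - + (2 ^ m) ≡ + 2 * + n →
             HasSize (Neighbour (Δ m [ c ]) (γ m i)) n
  Δ-degree c i eq = hasSize-γ (+ 2) _ proj₁
    (λ k → weighedBy-× (vertex-weighed k) (edge-weighed c i k))
    (trans (sumOver-cong (indices m) (λ k → ℤ.*-identityˡ (edgeWeight c m i k)))
      (trans (weight-sum c m i) eq))

  -- The factor 4 is the product of two edge weights 2. One count covers joined and unjoined pairs
  -- alike.
  Δ-common : ∀ c i j {n} → i ≢ j → + (4 ^ m) - + 2 * + (2 ^ m) ≡ + 4 * + n →
             HasSize (CommonNeighbour (Δ m [ c ]) (γ m i) (γ m j)) n
  Δ-common c i j i≢j eq = hasSize-γ (+ 4) _ proj₁
    (λ k → weighedBy-× (vertex-weighed k) (weighedBy-× (edge-weighed c i k) (edge-weighed c j k)))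
    (trans (sumOver-cong (indices m) (λ k → ℤ.*-identityˡ (edgeWeight c m i k * edgeWeight c m j k)))
      (trans (weight-product-sum c m i j i≢j) eq))

  Δ-isStronglyRegular : ∀ c {k l} →
    + (4 ^ m) - + (2 ^ m) ≡ + 2 * + k → + (4 ^ m) - + 2 * + (2 ^ m) ≡ + 4 * + l →
    IsStronglyRegular (Δ m [ c ]) (4 ^ m) k l l
  Δ-isStronglyRegular c k-eq l-eq = record
    { simple      = Δ-isSimple c
    ; order       = Δ-order c
    ; degree      = λ { (i , refl) → Δ-degree c i k-eq }
    -- Equal indices would make the edge a loop, so adjacent vertices have distinct indices.
    ; adjacent    = λ { (i , refl) (j , refl) edge →
        Δ-common c i j (λ { refl → edge-irreflexive c i edge }) l-eq }
    ; nonadjacent = λ { (i , refl) (j , refl) x≢y _ → Δ-common c i j (x≢y ∘ cong (γ m)) l-eq }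
    }

-- Arithmetic of the parameters.

pos-∸ : m ℕ.≤ n → + (n ∸ m) ≡ + n - + m
pos-∸ {m} {n} m≤n = sym (trans (ℤ.m-n≡m⊖n n m) (ℤ.⊖-≥ m≤n))

-- Ensures that the truncated subtractions in the parameters are genuine ones. The exponent is the
-- form to which `2 * n` reduces.
2^n≤2^[2n] : ∀ n → 2 ^ n ℕ.≤ 2 ^ (n ℕ.+ (n ℕ.+ 0))
2^n≤2^[2n] n = ℕ.^-monoʳ-≤ 2 (ℕ.m≤m+n n (n ℕ.+ 0))

pos-4^ : ∀ n → + (4 ^ suc n) ≡ + 4 * + (2 ^ (n ℕ.+ (n ℕ.+ 0)))
pos-4^ n = trans (cong (λ k → + (4 ℕ.* k)) (ℕ.^-*-assoc 2 2 n)) (ℤ.pos-* 4 (2 ^ (2 ℕ.* n)))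

-- For `m = suc n`, all terms are linear in `x`, which is 2^(m-1), and `y`, which is 2^(2m-2).
degree-value : ∀ m .{{_ : NonZero m}} →
               + (4 ^ m) - + (2 ^ m) ≡ + 2 * + (2 ^ (2 ℕ.* m ∸ 1) ∸ 2 ^ (m ∸ 1))
degree-value (suc n) = begin
  + (4 ^ suc n) - + (2 ^ suc n)
    ≡⟨ cong₂ _-_ (pos-4^ n) (ℤ.pos-* 2 (2 ^ n)) ⟩
  + 4 * y - + 2 * x
    ≡⟨ solve 2 (λ x y → con (+ 4) :* y :- con (+ 2) :* x := con (+ 2) :* (con (+ 2) :* y :- x)) refl x y ⟩
  + 2 * (+ 2 * y - x)
    ≡⟨ cong (λ z → + 2 * (z - x)) (ℤ.pos-* 2 (2 ^ (2 ℕ.* n))) ⟨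
  + 2 * (+ (2 ^ suc (2 ℕ.* n)) - x)
    ≡⟨ cong (+ 2 *_) (pos-∸ (ℕ.≤-trans (2^n≤2^[2n] n) (ℕ.m≤m+n _ _))) ⟨
  + 2 * + (2 ^ suc (2 ℕ.* n) ∸ 2 ^ n)
    -- `2 * suc n ∸ 1` reduces only to `n + suc (n + 0)`, so the inner successor has to be moved
    -- outwards.
    ≡⟨ cong (λ k → + 2 * + (2 ^ k ∸ 2 ^ n)) (ℕ.+-suc n (n ℕ.+ 0)) ⟨
  + 2 * + (2 ^ (2 ℕ.* suc n ∸ 1) ∸ 2 ^ n) ∎
  where
  open +-*-Solver
  x = + (2 ^ n)
  y = + (2 ^ (2 ℕ.* n))

common-value : ∀ m .{{_ : NonZero m}} →
               + (4 ^ m) - + 2 * + (2 ^ m) ≡ + 4 * + (2 ^ (2 ℕ.* m ∸ 2) ∸ 2 ^ (m ∸ 1))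
common-value (suc n) = begin
  + (4 ^ suc n) - + 2 * + (2 ^ suc n)
    ≡⟨ cong₂ (λ s t → s - + 2 * t) (pos-4^ n) (ℤ.pos-* 2 (2 ^ n)) ⟩
  + 4 * y - + 2 * (+ 2 * x)
    ≡⟨ solve 2 (λ x y → con (+ 4) :* y :- con (+ 2) :* (con (+ 2) :* x) := con (+ 4) :* (y :- x)) refl x y ⟩
  + 4 * (y - x)
    ≡⟨ cong (+ 4 *_) (pos-∸ (2^n≤2^[2n] n)) ⟨
  + 4 * + (2 ^ (2 ℕ.* n) ∸ 2 ^ n)
    ≡⟨ cong (λ k → + 4 * + (2 ^ (k ∸ 1) ∸ 2 ^ n)) (ℕ.+-suc n (n ℕ.+ 0)) ⟨
  + 4 * + (2 ^ (2 ℕ.* suc n ∸ 2) ∸ 2 ^ n) ∎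
  where
  open +-*-Solver
  x = + (2 ^ n)
  y = + (2 ^ (2 ℕ.* n))

theorem5p2 : ∀ (m : ℕ) .{{_ : NonZero m}} →
  let v = 4 ^ m
      k = 2 ^ (2 ℕ.* m ∸ 1) ∸ 2 ^ (m ∸ 1)
      l = 2 ^ (2 ℕ.* m ∸ 2) ∸ 2 ^ (m ∸ 1)
  in IsStronglyRegular (Δ m [ red ]) v k l l × IsStronglyRegular (Δ m [ blue ]) v k l l
theorem5p2 m =
  Δ-isStronglyRegular m red  (degree-value m) (common-value m) ,
  Δ-isStronglyRegular m blue (degree-value m) (common-value m)
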